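{- Let $A\in \mathbb{Z}^{m\times n}$ and $b\in \mathbb{Z}^m$. If $Ax\leq b$ is totally dual $p$-adic and totally dual $q$-adic for distinct primes $p,q$, then $\{x:Ax\leq b\}$ is an integral polyhedron.
   Context: For a prime $p$, a $p$-adic rational is a number of the form $a/p^k$ with $a,k$ integers and $k\geq 0$; a vector is $p$-adic if all its entries are $p$-adic rationals. The system $Ax\leq b$ is totally dual $p$-adic if for every $w\in\mathbb{Z}^n$ for which $\min\{b^\top y: A^\top y=w,\ y\geq \mathbf{0}\}$ has an optimal solution, it has a $p$-adic optimal solution. A rational polyhedron is integral if every nonempty face of it contains an integral point.
   Formalization: The points x of the polyhedron, the vectors and right-hand sides defining its faces, and the dual vectors y (in feasibility and optimality) range over rational rather than real numbers. -}

module Defs where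

open import Data.Nat as ℕ using (ℕ; zero; suc)
open import Data.Integer as ℤ using (ℤ; +_)
open import Data.Rational using (ℚ; _/_; 0ℚ; _+_; _*_; _≤_)
open import Data.Fin using (Fin; zero; suc)
open import Data.Product using (Σ; ∃; ∃-syntax; _×_)
open import Relation.Binary.PropositionalEquality using (_≡_)

Mat : ℕ → ℕ → Set
Mat m n = Fin m → Fin n → ℤ

ι : ℤ → ℚ
ι z = z / 1

∑ : ∀ {n} → (Fin n → ℚ) → ℚ
∑ {zero}  f = 0ℚ
∑ {suc n} f = f zero + ∑ (λ i → f (suc i))

rowDot : ∀ {m n} → Mat m n → Fin m → (Fin n → ℚ) → ℚ
rowDot A i x = ∑ (λ j → ι (A i j) * x j)

colDot : ∀ {m n} → Mat m n → Fin n → (Fin m → ℚ) → ℚ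
colDot A j y = ∑ (λ i → ι (A i j) * y i)

dot : ∀ {n} → (Fin n → ℚ) → (Fin n → ℚ) → ℚ
dot u v = ∑ (λ i → u i * v i)

InP : ∀ {m n} → Mat m n → (Fin m → ℤ) → (Fin n → ℚ) → Set
InP A b x = ∀ i → rowDot A i x ≤ ι (b i)

IsPAdic : ℕ → ℚ → Set
IsPAdic p r = ∃[ k ] ∃[ a ] (r * ι (+ (p ℕ.^ k)) ≡ ι a)

DualFeasible : ∀ {m n} → Mat m n → (Fin n → ℤ) → (Fin m → ℚ) → Set
DualFeasible A w y = (∀ j → colDot A j y ≡ ι (w j)) × (∀ i → 0ℚ ≤ y i)

DualOptimal : ∀ {m n} → Mat m n → (Fin m → ℤ) → (Fin n → ℤ) → (Fin m → ℚ) → Set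
DualOptimal A b w y =
  DualFeasible A w y ×
  (∀ y′ → DualFeasible A w y′ → dot (λ i → ι (b i)) y ≤ dot (λ i → ι (b i)) y′)

TotallyDualPAdic : ∀ {m n} → ℕ → Mat m n → (Fin m → ℤ) → Set
TotallyDualPAdic p A b =
  ∀ (w : _) → (∃[ y ] DualOptimal A b w y) →
    ∃[ y ] (DualOptimal A b w y × (∀ i → IsPAdic p (y i)))

IsIntegral : ∀ {n} → (Fin n → ℚ) → Set
IsIntegral x = ∀ j → ∃[ z ] (x j ≡ ι z)

-- a face of P is P ∩ {x : cᵀx = δ} for a valid inequality cᵀx ≤ δ (c ∈ ℚⁿ, δ ∈ ℚ);
-- P is integral iff every nonempty face contains an integral point
IsIntegralPolyhedron : ∀ {m n} → Mat m n → (Fin m → ℤ) → Set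
IsIntegralPolyhedron {n = n} A b =
  ∀ (c : Fin n → ℚ) (δ : ℚ) →
    (∀ x → InP A b x → dot c x ≤ δ) →
    (∃[ x ] (InP A b x × dot c x ≡ δ)) →
    ∃[ z ] (IsIntegral z × InP A b z × dot c z ≡ δ)

{-# OPTIONS --safe #-}

-- Let x lie in the face cᵀx = δ and let I be the set of rows tight at x.  If u ≥ 0 is supported
-- on I and w = Aᵀu is integral, then u is dual optimal for w by complementary slackness, so the
-- optimal value bᵀu is both p-adic and q-adic, hence an integer.  By Kronecker's criterion the
-- tight equations A_I z = b_I then have an integral solution z.  Moving from x towards z keeps
-- the rows in I tight and cᵀx constant: either z is reached inside the polyhedron, or a new row
-- becomes tight and the argument restarts with a larger I.
module Submission where

open import Defs
open import Data.Nat using (ℕ)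
open import Data.Nat.Primality using (Prime)
open import Data.Integer using (ℤ)
open import Data.Fin using (Fin)
open import Relation.Binary.PropositionalEquality using (_≢_)

open import Data.Fin using (zero; suc)
open import Data.Integer as ℤ using (+_; -[1+_]; 0ℤ; 1ℤ)
import Data.Integer.DivMod as ℤ
open import Data.Integer.Divisibility.Signed
import Data.Integer.Properties as ℤ
import Data.Integer.Tactic.RingSolver as ℤ-Solver
open import Data.List using (List; length; filter; allFin)
open import Data.List.Membership.Propositional using (_∈_; lose)
open import Data.List.Membership.Propositional.Properties using (∈-allFin; ∈-filter⁺)
open import Data.List.Properties using (filter-notAll)
open import Data.Nat as ℕ using (zero; suc)
open import Data.Nat.Coprimality as Coprime using (Coprime; coprime-divisor; coprime-factors)
import Data.Nat.Divisibility as ℕ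
open import Data.Nat.GCD as ℕ using (GCD; module Bézout)
open import Data.Nat.Primality using (prime⇒irreducible)
import Data.Nat.Properties as ℕ
open import Data.Product using (Σ-syntax; ∃-syntax; _×_; _,_; proj₁; proj₂; map₂)
open import Data.Rational as ℚ using (ℚ; 0ℚ; 1ℚ; _/_)
import Data.Rational.Properties as ℚ
import Data.Rational.Unnormalised as ℚᵘ
import Data.Rational.Unnormalised.Properties as ℚᵘ
open import Data.Sum using (_⊎_; inj₁; inj₂) renaming (map to map-⊎)
open import Data.Vec.Functional using (_∷_; tail)
open import Function using (_∘_; id; const)
open import Level using (0ℓ)
open import Relation.Binary.PropositionalEquality hiding (_≢_)
open import Relation.Nullary using (yes; no; ¬_; contradiction)
open import Relation.Nullary.Decidable using (¬?; dec⇒maybe)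
open import Relation.Unary using (Pred; Decidable)
open import Tactic.RingSolver using (solve-∀)
open import Tactic.RingSolver.Core.AlmostCommutativeRing using (AlmostCommutativeRing; fromCommutativeRing)

open import Algebra.Properties.Semiring.Sum ℤ.+-*-semiring
  using (sum; sum-cong-≗; ∑-distrib-+; *-distribˡ-sum; sum-replicate-zero)

-- Each prime's hypothesis supplies its own optimal dual vector, possibly different from `u` and
-- from the one for the other prime. They share only the optimal value, so it is the number bᵀu, and
-- not any vector, that turns out to be integral; numbers of this kind are what Kronecker's
-- criterion asks about. The criterion, however, tests multipliers of either sign, while dual
-- vectors are nonnegative. Adding an integer vector to a rational multiplier y supported on I
-- changes yᵀA and yᵀb only by integers, so y can be made nonnegative first. The polyhedron may have
-- no vertices, and z may violate rows outside I; hence the walk inside the face instead of a choice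
-- of vertex.

module IntegerLattice where

  open import Data.Integer using (_+_; _*_; -_; _-_)
  open ≡-Reasoning

  -- Integer dot products and lattices spanned by columns.

  infix 8 _·_
  _·_ : ∀ {m} → (Fin m → ℤ) → (Fin m → ℤ) → ℤ
  y · v = sum (λ i → y i * v i)

  ·-congʳ : ∀ {m} (y : Fin m → ℤ) {u v} → u ≗ v → y · u ≡ y · v
  ·-congʳ y u≗v = sum-cong-≗ (λ i → cong (y i *_) (u≗v i))

  ·-zeroʳ : ∀ {m} (y : Fin m → ℤ) → y · const 0ℤ ≡ 0ℤ
  ·-zeroʳ {m} y = trans (sum-cong-≗ (λ i → ℤ.*-zeroʳ (y i))) (sum-replicate-zero m)

  ·-zeroˡ : ∀ {m} (v : Fin m → ℤ) → const 0ℤ · v ≡ 0ℤ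
  ·-zeroˡ {m} v = sum-replicate-zero m

  ·-comm : ∀ {m} (u v : Fin m → ℤ) → u · v ≡ v · u
  ·-comm u v = sum-cong-≗ (λ i → ℤ.*-comm (u i) (v i))

  ·-linearʳ : ∀ {m} (y : Fin m → ℤ) s u t v → y · (λ i → s * u i + t * v i) ≡ s * y · u + t * y · v
  ·-linearʳ y s u t v = begin
    y · (λ i → s * u i + t * v i)                           ≡⟨ sum-cong-≗ (λ i → rearrange (y i) s (u i) t (v i)) ⟩
    sum (λ i → s * (y i * u i) + t * (y i * v i))           ≡⟨ ∑-distrib-+ (λ i → s * (y i * u i)) (λ i → t * (y i * v i)) ⟩
    sum (λ i → s * (y i * u i)) + sum (λ i → t * (y i * v i)) ≡⟨ cong₂ _+_ (*-distribˡ-sum s (λ i → y i * u i)) (*-distribˡ-sum t (λ i → y i * v i)) ⟨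
    s * y · u + t * y · v                                   ∎
    where
    rearrange : ∀ a b c d e → a * (b * c + d * e) ≡ b * (a * c) + d * (a * e)
    rearrange = ℤ-Solver.solve-∀

  ·-scaleˡ : ∀ {m} s (y v : Fin m → ℤ) → (λ i → s * y i) · v ≡ s * y · v
  ·-scaleˡ s y v = trans (sum-cong-≗ (λ i → ℤ.*-assoc s (y i) (v i))) (sym (*-distribˡ-sum s (λ i → y i * v i)))

  e₀ : ∀ {m} → Fin (suc m) → ℤ
  e₀ = 1ℤ ∷ const 0ℤ

  e₀-· : ∀ {m} (v : Fin (suc m) → ℤ) → e₀ · v ≡ v zero
  e₀-· v = trans (cong₂ _+_ (ℤ.*-identityˡ (v zero)) (·-zeroˡ (tail v))) (ℤ.+-identityʳ (v zero))

  -- The lattice generated by the columns, as an inductive closure: inclusions and divisibility then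
  -- go by induction, and coefficients are extracted only at the end. Each constructor carries a
  -- pointwise equation because vectors are functions.
  data Span {m n} (V : Fin n → Fin m → ℤ) (w : Fin m → ℤ) : Set where
    null : w ≗ const 0ℤ → Span V w
    gen  : ∀ j → w ≗ V j → Span V w
    comb : ∀ s t {u v} → Span V u → Span V v → w ≗ (λ i → s * u i + t * v i) → Span V w

  Span-trans : ∀ {m k n} {V : Fin k → Fin m → ℤ} {W : Fin n → Fin m → ℤ} {u} →
    (∀ j → Span W (V j)) → Span V u → Span W u
  Span-trans V⊆W (null u≗0)       = null u≗0
  Span-trans V⊆W (gen j u≗Vj) with V⊆W j
  ... | null e = null (λ i → trans (u≗Vj i) (e i))
  ... | gen k e = gen k (λ i → trans (u≗Vj i) (e i))
  ... | comb s t p q e = comb s t p q (λ i → trans (u≗Vj i) (e i))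
  Span-trans V⊆W (comb s t p q e) = comb s t (Span-trans V⊆W p) (Span-trans V⊆W q) e

  Span-0∷ : ∀ {m n} {W : Fin n → Fin m → ℤ} {u} → Span W u → Span (λ j → 0ℤ ∷ W j) (0ℤ ∷ u)
  Span-0∷ (null e)         = null λ { zero → refl ; (suc i) → e i }
  Span-0∷ (gen j e)        = gen j λ { zero → refl ; (suc i) → e i }
  Span-0∷ (comb s t p q e) = comb s t (Span-0∷ p) (Span-0∷ q)
    λ { zero → sym (cong₂ _+_ (ℤ.*-zeroʳ s) (ℤ.*-zeroʳ t)) ; (suc i) → e i }

  Span-coefficients : ∀ {m n} {V : Fin n → Fin m → ℤ} {w} → Span V w →
    ∃[ z ] (∀ i → w i ≡ z · (λ j → V j i))
  Span-coefficients {V = V} (null e) = const 0ℤ , λ i → trans (e i) (sym (·-zeroˡ (λ j → V j i)))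
  Span-coefficients {V = V} (gen j e) = δ j , λ i → trans (e i) (sym (δ-· j (λ k → V k i)))
    where
    δ : ∀ {n} → Fin n → Fin n → ℤ
    δ zero    = e₀
    δ (suc j) = 0ℤ ∷ δ j
    δ-· : ∀ {n} (j : Fin n) v → δ j · v ≡ v j
    δ-· zero    v = e₀-· v
    δ-· (suc j) v = trans (ℤ.+-identityˡ _) (δ-· j (tail v))
  Span-coefficients {V = V} {w} (comb s t {u} {v} p q e)
    with y , u≗ ← Span-coefficients p | z , v≗ ← Span-coefficients q =
    (λ j → s * y j + t * z j) , λ i → begin
      w i                                         ≡⟨ e i ⟩
      s * u i + t * v i                           ≡⟨ cong₂ (λ a b → s * a + t * b) (trans (u≗ i) (·-comm y (λ j → V j i))) (trans (v≗ i) (·-comm z (λ j → V j i))) ⟩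
      s * (λ j → V j i) · y + t * (λ j → V j i) · z ≡⟨ ·-linearʳ (λ j → V j i) s y t z ⟨
      (λ j → V j i) · (λ j → s * y j + t * z j)   ≡⟨ ·-comm (λ j → V j i) (λ j → s * y j + t * z j) ⟩
      (λ j → s * y j + t * z j) · (λ j → V j i)   ∎

  ∣-Span : ∀ {m n} {V : Fin n → Fin m → ℤ} {w} N y → (∀ j → N ∣ y · V j) → Span V w → N ∣ y · w
  ∣-Span N y N∣V (null e)  = subst (N ∣_) (sym (trans (·-congʳ y e) (·-zeroʳ y))) (divides 0ℤ refl)
  ∣-Span N y N∣V (gen j e) = subst (N ∣_) (sym (·-congʳ y e)) (N∣V j)
  ∣-Span N y N∣V (comb s t p q e) = subst (N ∣_) (sym (trans (·-congʳ y e) (·-linearʳ y s _ t _)))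
    (∣m∣n⇒∣m+n (∣n⇒∣m*n s (∣-Span N y N∣V p)) (∣n⇒∣m*n t (∣-Span N y N∣V q)))

  -- Bézout coefficients, column reduction and Kronecker's criterion.

  private
    signed : ∀ x → ∃[ ε ] + ℤ.∣ x ∣ ≡ ε * x
    signed (+ n)    = 1ℤ , sym (ℤ.*-identityˡ _)
    signed -[1+ n ] = - 1ℤ , sym (ℤ.-1*i≡-i -[1+ n ])

  bézout-ℕ : ∀ {d m n} → Bézout.Identity d m n → ∃[ s ] ∃[ t ] (+ d ≡ s * + m + t * + n)
  bézout-ℕ {d} {m} {n} (Bézout.+- x y d+yn≡xm) = + x , - (+ y) , (begin
    + d                                        ≡⟨ add-sub (+ d) (+ y * + n) ⟩
    (+ d + + y * + n) + - (+ y * + n)          ≡⟨ cong₂ _+_ (lift d y n x m d+yn≡xm) (ℤ.neg-distribˡ-* (+ y) (+ n)) ⟩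
    + x * + m + - (+ y) * + n                  ∎)
    where
    add-sub : ∀ a b → a ≡ (a + b) + - b
    add-sub = ℤ-Solver.solve-∀
    lift : ∀ d y n x m → d ℕ.+ y ℕ.* n ≡ x ℕ.* m → + d + + y * + n ≡ + x * + m
    lift d y n x m eq = trans (cong (λ z → + d + z) (sym (ℤ.pos-* y n))) (trans (cong +_ eq) (ℤ.pos-* x m))
  bézout-ℕ {d} {m} {n} (Bézout.-+ x y eq) with t , s , d≡ ← bézout-ℕ {d} {n} {m} (Bézout.+- y x eq) =
    s , t , trans d≡ (ℤ.+-comm (t * + n) (s * + m))

  bézout : ∀ a c → ∃[ g ] ∃[ s ] ∃[ t ] (g ≡ s * a + t * c × g ∣ a × g ∣ c)
  bézout a c
    with d , gcd ← ℕ.mkGCD ℤ.∣ a ∣ ℤ.∣ c ∣ | α , ∣a∣≡αa ← signed a | γ , ∣c∣≡γc ← signed c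
    with s , t , d≡ ← bézout-ℕ (Bézout.identity gcd) =
    + d , s * α , t * γ ,
    trans d≡ (cong₂ _+_ (trans (cong (s *_) ∣a∣≡αa) (sym (ℤ.*-assoc s α a)))
                        (trans (cong (t *_) ∣c∣≡γc) (sym (ℤ.*-assoc t γ c)))) ,
    ∣ᵤ⇒∣ (GCD.gcd∣m gcd) , ∣ᵤ⇒∣ (GCD.gcd∣n gcd)

  -- One step of column reduction to Hermite normal form: the columns V and the columns
  -- h, (0, W j) generate the same lattice.
  record RowReduced {m n} (V : Fin n → Fin (suc m) → ℤ) : Set where
    field
      h     : Fin (suc m) → ℤ
      W     : Fin n → Fin m → ℤ
    reduced : Fin (suc n) → Fin (suc m) → ℤ
    reduced = h ∷ λ j → 0ℤ ∷ W j
    field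
      h∈V      : Span V h
      W∈V      : ∀ j → Span V (0ℤ ∷ W j)
      V∈       : ∀ j → Span reduced (V j)
      -- To lift a test vector so that it annihilates `h`, `kronecker` divides by the pivot
      -- `h zero`. When the pivot is zero, this field makes every lift annihilate `h`.
      h₀≡0⇒h≡0 : h zero ≡ 0ℤ → h ≗ const 0ℤ

  -- Columns enter one at a time. A column with first entry zero joins `W` unchanged; any other is
  -- merged with the old pivot column by a Euclidean step, which leaves one column headed by the gcd
  -- and one headed by zero.
  rowReduce : ∀ {m n} (V : Fin n → Fin (suc m) → ℤ) → RowReduced V
  rowReduce {n = zero} V = record
    { h = const 0ℤ ; W = λ () ; h∈V = null (λ _ → refl) ; W∈V = λ () ; V∈ = λ ()
    ; h₀≡0⇒h≡0 = λ _ _ → refl }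
  rowReduce {n = suc n} V with rowReduce (tail V) | V zero zero ℤ.≟ 0ℤ
  ... | R | yes V₀₀≡0 = record
    { h = h ; W = tail (V zero) ∷ W
    ; h∈V = Span-trans V′∈V h∈V
    ; W∈V = λ { zero → gen zero 0∷V₀≗V₀ ; (suc j) → Span-trans V′∈V (W∈V j) }
    ; V∈ = λ { zero → gen (suc zero) (sym ∘ 0∷V₀≗V₀)
             ; (suc j) → Span-trans (λ { zero → gen zero (λ _ → refl) ; (suc k) → gen (suc (suc k)) (λ _ → refl) }) (V∈ j) }
    ; h₀≡0⇒h≡0 = h₀≡0⇒h≡0 }
    where
    open RowReduced R
    V′∈V : ∀ j → Span V (V (suc j))
    V′∈V j = gen (suc j) (λ _ → refl)
    0∷V₀≗V₀ : (0ℤ ∷ tail (V zero)) ≗ V zero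
    0∷V₀≗V₀ zero    = sym V₀₀≡0
    0∷V₀≗V₀ (suc i) = refl
  ... | R | no V₀₀≢0
    with g , s , t , g≡ , divides a a≡ , divides c c≡ ← bézout (V zero zero) (RowReduced.h R zero) = record
    { h = h′ ; W = tail w ∷ W
    ; h∈V = h′∈V
    ; W∈V = λ { zero → comb c (- a) (gen zero (λ _ → refl)) (Span-trans V′∈V h∈V) 0∷w≗w
              ; (suc j) → Span-trans V′∈V (W∈V j) }
    ; V∈ = λ { zero → comb a t (gen zero (λ _ → refl)) (gen (suc zero) (λ _ → refl)) V₀≗
             ; (suc j) → Span-trans (λ { zero → comb c (- s) (gen zero (λ _ → refl)) (gen (suc zero) (λ _ → refl)) h≗
                                       ; (suc k) → gen (suc (suc k)) (λ _ → refl) }) (V∈ j) }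
    ; h₀≡0⇒h≡0 = λ g≡0 → contradiction (trans a≡ (trans (cong (a *_) (trans g≡ g≡0)) (ℤ.*-zeroʳ a))) V₀₀≢0 }
    where
    open RowReduced R
    -- The coefficient rows (s, t) and (c, -a) have determinant -(sa + tc) = -1, so the change of
    -- generators is invertible over the integers; the rows (a, t) and (c, -s) of the inverse
    -- reappear in `V₀≗` and `h≗`.
    h′ w : Fin _ → ℤ
    h′ i = s * V zero i + t * h i
    w  i = c * V zero i + (- a) * h i
    V′∈V : ∀ j → Span V (V (suc j))
    V′∈V j = gen (suc j) (λ _ → refl)
    h′∈V : Span V h′
    h′∈V = comb s t (gen zero (λ _ → refl)) (Span-trans V′∈V h∈V) (λ _ → refl)
    instance
      g≢0 : ℤ.NonZero g
      g≢0 = ℤ.≢-nonZero λ g≡0 → V₀₀≢0 (trans a≡ (trans (cong (a *_) g≡0) (ℤ.*-zeroʳ a)))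
    sa+tc≡1 : s * a + t * c ≡ 1ℤ
    sa+tc≡1 = ℤ.*-cancelʳ-≡ _ _ g (begin
      (s * a + t * c) * g           ≡⟨ expand s a t c g ⟩
      s * (a * g) + t * (c * g)     ≡⟨ cong₂ (λ x y → s * x + t * y) a≡ c≡ ⟨
      s * V zero zero + t * h zero  ≡⟨ g≡ ⟨
      g                             ≡⟨ ℤ.*-identityˡ g ⟨
      1ℤ * g                        ∎)
      where
      expand : ∀ s a t c g → (s * a + t * c) * g ≡ s * (a * g) + t * (c * g)
      expand = ℤ-Solver.solve-∀
    0∷w≗w : (0ℤ ∷ tail w) ≗ w
    0∷w≗w zero = sym (begin
      c * V zero zero + (- a) * h zero ≡⟨ cong₂ (λ x y → c * x + (- a) * y) a≡ c≡ ⟩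
      c * (a * g) + (- a) * (c * g)    ≡⟨ cancel a c g ⟩
      0ℤ                               ∎)
      where
      cancel : ∀ a c g → c * (a * g) + (- a) * (c * g) ≡ 0ℤ
      cancel = ℤ-Solver.solve-∀
    0∷w≗w (suc i) = refl
    V₀≗ : V zero ≗ (λ i → a * h′ i + t * (0ℤ ∷ tail w) i)
    V₀≗ i = begin
      V zero i                                            ≡⟨ ℤ.*-identityˡ _ ⟨
      1ℤ * V zero i                                       ≡⟨ cong (_* V zero i) sa+tc≡1 ⟨
      (s * a + t * c) * V zero i                          ≡⟨ invert s a t c (V zero i) (h i) ⟩
      a * h′ i + t * w i                                  ≡⟨ cong (λ x → a * h′ i + t * x) (0∷w≗w i) ⟨
      a * h′ i + t * (0ℤ ∷ tail w) i                      ∎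
      where
      invert : ∀ s a t c v h → (s * a + t * c) * v ≡ a * (s * v + t * h) + t * (c * v + (- a) * h)
      invert = ℤ-Solver.solve-∀
    h≗ : h ≗ (λ i → c * h′ i + (- s) * (0ℤ ∷ tail w) i)
    h≗ i = begin
      h i                                                 ≡⟨ ℤ.*-identityˡ _ ⟨
      1ℤ * h i                                            ≡⟨ cong (_* h i) sa+tc≡1 ⟨
      (s * a + t * c) * h i                               ≡⟨ invert s a t c (V zero i) (h i) ⟩
      c * h′ i + (- s) * w i                              ≡⟨ cong (λ x → c * h′ i + (- s) * x) (0∷w≗w i) ⟨
      c * h′ i + (- s) * (0ℤ ∷ tail w) i                  ∎
      where
      invert : ∀ s a t c v h → (s * a + t * c) * h ≡ c * (s * v + t * h) + (- s) * (c * v + (- a) * h)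
      invert = ℤ-Solver.solve-∀

  ∷-·-0∷ : ∀ {m} y₀ (y w : Fin m → ℤ) → (y₀ ∷ y) · (0ℤ ∷ w) ≡ y · w
  ∷-·-0∷ y₀ y w = trans (cong (_+ y · w) (ℤ.*-zeroʳ y₀)) (ℤ.+-identityˡ (y · w))

  module _ {m n} {V : Fin n → Fin (suc m) → ℤ} (R : RowReduced V) where
    open RowReduced R

    ∣-rowReduced : ∀ N y → N ∣ y · h → (∀ j → N ∣ y · (0ℤ ∷ W j)) → ∀ j → N ∣ y · V j
    ∣-rowReduced N y N∣h N∣W j = ∣-Span N y (λ { zero → N∣h ; (suc k) → N∣W k }) (V∈ j)

    -- The reduced columns have first entries `h zero` and 0. In terms of `e₀`, this is the premise
    -- of Kronecker's condition for the test vector `e₀` with denominator `h zero`.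
    h₀∣V₀ : ∀ j → h zero ∣ e₀ · V j
    h₀∣V₀ = ∣-rowReduced (h zero) e₀ (subst (h zero ∣_) (sym (e₀-· h)) ∣-refl)
      (λ j → subst (h zero ∣_) (sym (e₀-· (0ℤ ∷ W j))) (divides 0ℤ refl))

  -- Kronecker's integrality criterion: b is an integer combination of the columns V as soon
  -- as, for y rational, integrality of all y·V j implies that of y·b; y has here been
  -- multiplied by a common denominator N.
  kronecker : ∀ {m n} (V : Fin n → Fin m → ℤ) (b : Fin m → ℤ) →
    (∀ N y → (∀ j → N ∣ y · V j) → N ∣ y · b) → Span V b
  kronecker {zero}  V b H = null λ ()
  kronecker {suc m} V b H with R ← rowReduce V
    -- A zero pivot is covered too: the denominator is then 0, and divisibility by 0 yields
    -- `b zero ≡ 0ℤ`. This is why `N` is allowed to be zero here.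
    with divides t b₀≡tg ← subst (RowReduced.h R zero ∣_) (e₀-· b) (H (RowReduced.h R zero) e₀ (h₀∣V₀ R)) = conclusion
    where
    open RowReduced R
    g : ℤ
    g = h zero
    b′ : Fin m → ℤ
    b′ i = b (suc i) - t * h (suc i)
    ·b′ : ∀ y → y · b′ ≡ y · tail b - t * y · tail h
    ·b′ y = begin
      y · b′                                      ≡⟨ ·-congʳ y (λ i → sub (b (suc i)) t (h (suc i))) ⟩
      y · (λ i → 1ℤ * b (suc i) + (- t) * h (suc i)) ≡⟨ ·-linearʳ y 1ℤ (tail b) (- t) (tail h) ⟩
      1ℤ * y · tail b + (- t) * y · tail h        ≡⟨ sub (y · tail b) t (y · tail h) ⟨
      y · tail b - t * y · tail h                 ∎
      where
      sub : ∀ b t h → b - t * h ≡ 1ℤ * b + (- t) * h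
      sub = ℤ-Solver.solve-∀
    H″ : ∀ N y → (∀ j → N ∣ y · W j) → N ∣ y · b′
    H″ N y N∣W with g ℤ.≟ 0ℤ
    ... | yes g≡0 = subst (N ∣_) y·b≡ (H N (0ℤ ∷ y) (∣-rowReduced R N (0ℤ ∷ y)
          (subst (N ∣_) (sym (trans (·-congʳ (0ℤ ∷ y) h≡0) (·-zeroʳ (0ℤ ∷ y)))) (divides 0ℤ refl))
          (λ j → subst (N ∣_) (sym (∷-·-0∷ 0ℤ y (W j))) (N∣W j))))
      where
      h≡0 = h₀≡0⇒h≡0 g≡0
      y·b≡ : (0ℤ ∷ y) · b ≡ y · b′
      y·b≡ = trans (ℤ.+-identityˡ _) (sym (·-congʳ y (λ i →
        trans (cong (λ x → b (suc i) - t * x) (h≡0 (suc i)))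
              (trans (cong (λ x → b (suc i) - x) (ℤ.*-zeroʳ t)) (ℤ.+-identityʳ (b (suc i)))))))
    -- The lift (- (y·h)/g, y) of y annihilates h; it is multiplied by g to stay integral.
    ... | no g≢0 = *-cancelˡ-∣ g {{ℤ.≢-nonZero g≢0}} (subst (g * N ∣_) ỹ·b≡ (H (g * N) ỹ (∣-rowReduced R (g * N) ỹ
          (subst (g * N ∣_) (sym ỹ·h≡0) (divides 0ℤ refl))
          (λ j → subst (g * N ∣_) (sym (trans (∷-·-0∷ (- (y · tail h)) gy (W j)) (·-scaleˡ g y (W j)))) (*-monoʳ-∣ g (N∣W j))))))
      where
      gy : Fin m → ℤ
      gy i = g * y i
      ỹ : Fin (suc m) → ℤ
      ỹ = (- (y · tail h)) ∷ gy
      ỹ·h≡0 : ỹ · h ≡ 0ℤ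
      ỹ·h≡0 = trans (cong (λ z → - (y · tail h) * g + z) (·-scaleˡ g y (tail h))) (cancel (y · tail h) g)
        where
        cancel : ∀ x g → (- x) * g + g * x ≡ 0ℤ
        cancel = ℤ-Solver.solve-∀
      ỹ·b≡ : ỹ · b ≡ g * y · b′
      ỹ·b≡ = begin
        - (y · tail h) * b zero + gy · tail b ≡⟨ cong₂ (λ p q → - (y · tail h) * p + q) (b₀≡tg) (·-scaleˡ g y (tail b)) ⟩
        - (y · tail h) * (t * g) + g * y · tail b ≡⟨ factor (y · tail h) t g (y · tail b) ⟩
        g * (y · tail b - t * y · tail h) ≡⟨ cong (g *_) (·b′ y) ⟨
        g * y · b′ ∎
        where
        factor : ∀ x t g z → (- x) * (t * g) + g * z ≡ g * (z - t * x)
        factor = ℤ-Solver.solve-∀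
    conclusion : Span V b
    conclusion = comb t 1ℤ h∈V (Span-trans W∈V (Span-0∷ (kronecker W b′ H″)))
      λ { zero → trans (b₀≡tg) (sym (ℤ.+-identityʳ (t * g))) ; (suc i) → add-back (b (suc i)) (t * h (suc i)) }
      where
      add-back : ∀ b c → b ≡ c + 1ℤ * (b - c)
      add-back = ℤ-Solver.solve-∀

  -- Denominators of actual dual vectors are positive. A negative `N` has the same multiples as its
  -- absolute value, and for `N` zero all `y · V j` vanish, so that every positive integer divides
  -- them and hence divides `y · b`.
  kronecker⁺ : ∀ {m n} (V : Fin n → Fin m → ℤ) (b : Fin m → ℤ) →
    (∀ N .{{_ : ℕ.NonZero N}} y → (∀ j → + N ∣ y · V j) → + N ∣ y · b) → Span V b
  kronecker⁺ V b H = kronecker V b H′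
    where
    H′ : ∀ N y → (∀ j → N ∣ y · V j) → N ∣ y · b
    H′ N y N∣V with N ℤ.≟ 0ℤ
    ... | no N≢0 = ∣-trans m∣∣m∣ (H ℤ.∣ N ∣ {{ℤ.≢-nonZero N≢0}} y (λ j → ∣-trans ∣m∣∣m (N∣V j)))
    -- A number divisible by its absolute value plus one is zero.
    ... | yes refl = divides 0ℤ (ℤ.∣i∣≡0⇒i≡0 (vanishes ℤ.∣ y · b ∣ (∣⇒∣ᵤ
          (H (suc ℤ.∣ y · b ∣) y (λ j → ∣-trans (divides 0ℤ refl) (N∣V j))))))
      where
      vanishes : ∀ k → suc k ℕ.∣ k → k ≡ 0
      vanishes zero    _   = refl
      vanishes (suc k) k∣k = contradiction k∣k (ℕ.>⇒∤ ℕ.≤-refl)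

open IntegerLattice
open import Data.Rational using (_+_; _*_; _-_; -_; _≤_; _<_)

-- Rational arithmetic: the embedding `ι`, finite sums and dot products.

ℚ-ring : AlmostCommutativeRing 0ℓ 0ℓ
ℚ-ring = fromCommutativeRing ℚ.+-*-commutativeRing (λ r → dec⇒maybe (0ℚ ℚ.≟ r))


-- Since `_/_` normalises by a gcd, the equation is checked on unnormalised fractions, where it is a
-- polynomial identity.
ι-+ : ∀ a b → ι (a ℤ.+ b) ≡ ι a + ι b
ι-+ a b = ℚ.toℚᵘ-injective (begin
  ℚ.toℚᵘ (ι (a ℤ.+ b))              ≈⟨ ℚ.toℚᵘ-fromℚᵘ (ℚᵘ.mkℚᵘ (a ℤ.+ b) 0) ⟩
  ℚᵘ.mkℚᵘ (a ℤ.+ b) 0               ≈⟨ ℚᵘ.*≡* (same a b) ⟩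
  ℚᵘ.mkℚᵘ a 0 ℚᵘ.+ ℚᵘ.mkℚᵘ b 0      ≈⟨ ℚᵘ.+-cong (ℚ.toℚᵘ-fromℚᵘ (ℚᵘ.mkℚᵘ a 0)) (ℚ.toℚᵘ-fromℚᵘ (ℚᵘ.mkℚᵘ b 0)) ⟨
  ℚ.toℚᵘ (ι a) ℚᵘ.+ ℚ.toℚᵘ (ι b)    ≈⟨ ℚ.toℚᵘ-homo-+ (ι a) (ι b) ⟨
  ℚ.toℚᵘ (ι a + ι b)                ∎)
  where
  open ℚᵘ.≃-Reasoning
  same : ∀ a b → (a ℤ.+ b) ℤ.* 1ℤ ≡ (a ℤ.* 1ℤ ℤ.+ b ℤ.* 1ℤ) ℤ.* 1ℤ
  same = ℤ-Solver.solve-∀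

ι-* : ∀ a b → ι (a ℤ.* b) ≡ ι a * ι b
ι-* a b = ℚ.toℚᵘ-injective (begin
  ℚ.toℚᵘ (ι (a ℤ.* b))              ≈⟨ ℚ.toℚᵘ-fromℚᵘ (ℚᵘ.mkℚᵘ (a ℤ.* b) 0) ⟩
  ℚᵘ.mkℚᵘ a 0 ℚᵘ.* ℚᵘ.mkℚᵘ b 0      ≈⟨ ℚᵘ.*-cong (ℚ.toℚᵘ-fromℚᵘ (ℚᵘ.mkℚᵘ a 0)) (ℚ.toℚᵘ-fromℚᵘ (ℚᵘ.mkℚᵘ b 0)) ⟨
  ℚ.toℚᵘ (ι a) ℚᵘ.* ℚ.toℚᵘ (ι b)    ≈⟨ ℚ.toℚᵘ-homo-* (ι a) (ι b) ⟨
  ℚ.toℚᵘ (ι a * ι b)                ∎)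
  where open ℚᵘ.≃-Reasoning

ι-injective : ∀ a b → ι a ≡ ι b → a ≡ b
ι-injective a b eq with ℚᵘ.*≡* e ← ℚ.fromℚᵘ-injective {ℚᵘ.mkℚᵘ a 0} {ℚᵘ.mkℚᵘ b 0} eq =
  trans (sym (ℤ.*-identityʳ a)) (trans e (ℤ.*-identityʳ b))

a/n*n : ∀ a n .{{_ : ℕ.NonZero n}} → (a / n) * ι (+ n) ≡ ι a
a/n*n a n@(suc k) = ℚ.toℚᵘ-injective (begin
  ℚ.toℚᵘ (a / n * ι (+ n))          ≈⟨ ℚ.toℚᵘ-homo-* (a / n) (ι (+ n)) ⟩
  ℚ.toℚᵘ (a / n) ℚᵘ.* ℚ.toℚᵘ (ι (+ n)) ≈⟨ ℚᵘ.*-cong (ℚ.toℚᵘ-fromℚᵘ (ℚᵘ.mkℚᵘ a k)) (ℚ.toℚᵘ-fromℚᵘ (ℚᵘ.mkℚᵘ (+ n) 0)) ⟩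
  ℚᵘ.mkℚᵘ a k ℚᵘ.* ℚᵘ.mkℚᵘ (+ n) 0  ≈⟨ ℚᵘ.*≡* (trans (ℤ.*-identityʳ (a ℤ.* + n)) (cong (λ l → a ℤ.* + l) (sym (ℕ.*-identityʳ n)))) ⟩
  ℚᵘ.mkℚᵘ a 0                       ≈⟨ ℚ.toℚᵘ-fromℚᵘ (ℚᵘ.mkℚᵘ a 0) ⟨
  ℚ.toℚᵘ (ι a)                      ∎)
  where open ℚᵘ.≃-Reasoning

∑-cong : ∀ {n} {f g : Fin n → ℚ} → f ≗ g → ∑ f ≡ ∑ g
∑-cong {zero}  f≗g = refl
∑-cong {suc n} f≗g = cong₂ _+_ (f≗g zero) (∑-cong (λ i → f≗g (suc i)))

∑-zero : ∀ n → ∑ {n} (λ _ → 0ℚ) ≡ 0ℚ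
∑-zero zero    = refl
∑-zero (suc n) = trans (ℚ.+-identityˡ _) (∑-zero n)

∑-+ : ∀ {n} (f g : Fin n → ℚ) → ∑ (λ i → f i + g i) ≡ ∑ f + ∑ g
∑-+ {zero}  f g = refl
∑-+ {suc n} f g = trans (cong (λ s → f zero + g zero + s) (∑-+ (λ i → f (suc i)) (λ i → g (suc i))))
                        (interchange (f zero) (g zero) _ _)
  where
  interchange : ∀ a b c d → (a + b) + (c + d) ≡ (a + c) + (b + d)
  interchange = solve-∀ ℚ-ring

∑-*ˡ : ∀ {n} r (f : Fin n → ℚ) → ∑ (λ i → r * f i) ≡ r * ∑ f
∑-*ˡ {zero}  r f = sym (ℚ.*-zeroʳ r)
∑-*ˡ {suc n} r f = trans (cong (λ s → r * f zero + s) (∑-*ˡ r (λ i → f (suc i)))) (sym (ℚ.*-distribˡ-+ r (f zero) _))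

∑-swap : ∀ {m n} (f : Fin m → Fin n → ℚ) → ∑ (λ i → ∑ (f i)) ≡ ∑ (λ j → ∑ (λ i → f i j))
∑-swap {zero}  {n} f = sym (∑-zero n)
∑-swap {suc m} {n} f = trans (cong (λ s → ∑ (f zero) + s) (∑-swap (λ i → f (suc i)))) (sym (∑-+ (f zero) _))

∑-mono-≤ : ∀ {n} {f g : Fin n → ℚ} → (∀ i → f i ≤ g i) → ∑ f ≤ ∑ g
∑-mono-≤ {zero}  f≤g = ℚ.≤-refl
∑-mono-≤ {suc n} f≤g = ℚ.+-mono-≤ (f≤g zero) (∑-mono-≤ (λ i → f≤g (suc i)))

dot-line : ∀ {n} (a x d : Fin n → ℚ) r → dot a (λ j → x j + r * d j) ≡ dot a x + r * dot a d
dot-line a x d r = begin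
  ∑ (λ j → a j * (x j + r * d j))         ≡⟨ ∑-cong (λ j → expand (a j) (x j) r (d j)) ⟩
  ∑ (λ j → a j * x j + r * (a j * d j))   ≡⟨ ∑-+ (λ j → a j * x j) (λ j → r * (a j * d j)) ⟩
  dot a x + ∑ (λ j → r * (a j * d j))     ≡⟨ cong (λ s → dot a x + s) (∑-*ˡ r (λ j → a j * d j)) ⟩
  dot a x + r * dot a d                   ∎
  where
  open ≡-Reasoning
  expand : ∀ a x r d → a * (x + r * d) ≡ a * x + r * (a * d)
  expand = solve-∀ ℚ-ring

dot-scale : ∀ {n} (a y : Fin n → ℚ) r → dot a (λ j → y j * r) ≡ dot a y * r
dot-scale a y r = begin
  ∑ (λ j → a j * (y j * r))  ≡⟨ ∑-cong (λ j → rotate (a j) (y j) r) ⟩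
  ∑ (λ j → r * (a j * y j))  ≡⟨ ∑-*ˡ r (λ j → a j * y j) ⟩
  r * dot a y                ≡⟨ ℚ.*-comm r (dot a y) ⟩
  dot a y * r                ∎
  where
  open ≡-Reasoning
  rotate : ∀ a y r → a * (y * r) ≡ r * (a * y)
  rotate = solve-∀ ℚ-ring

ι-dot : ∀ {n} (u v : Fin n → ℤ) → dot (λ i → ι (v i)) (λ i → ι (u i)) ≡ ι (u · v)
ι-dot {zero}  u v = refl
ι-dot {suc n} u v = begin
  ι (v zero) * ι (u zero) + dot (λ i → ι (v (suc i))) (λ i → ι (u (suc i)))
    ≡⟨ cong₂ _+_ (trans (ℚ.*-comm (ι (v zero)) (ι (u zero))) (sym (ι-* (u zero) (v zero)))) (ι-dot (λ i → u (suc i)) (λ i → v (suc i))) ⟩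
  ι (u zero ℤ.* v zero) + ι ((λ i → u (suc i)) · (λ i → v (suc i)))
    ≡⟨ ι-+ (u zero ℤ.* v zero) ((λ i → u (suc i)) · (λ i → v (suc i))) ⟨
  ι (u · v) ∎
  where open ≡-Reasoning

-- The double sum yᵀAx, evaluated in its two orders.
colDot-rowDot : ∀ {m n} (A : Mat m n) (x : Fin n → ℚ) (y : Fin m → ℚ) →
  ∑ (λ j → colDot A j y * x j) ≡ ∑ (λ i → rowDot A i x * y i)
colDot-rowDot A x y = begin
  ∑ (λ j → colDot A j y * x j)                       ≡⟨ ∑-cong (λ j → trans (ℚ.*-comm (colDot A j y) (x j)) (sym (∑-*ˡ (x j) (λ i → ι (A i j) * y i)))) ⟩
  ∑ (λ j → ∑ (λ i → x j * (ι (A i j) * y i)))        ≡⟨ ∑-swap (λ j i → x j * (ι (A i j) * y i)) ⟩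
  ∑ (λ i → ∑ (λ j → x j * (ι (A i j) * y i)))        ≡⟨ ∑-cong (λ i → ∑-cong (λ j → rotate (x j) (ι (A i j)) (y i))) ⟩
  ∑ (λ i → ∑ (λ j → y i * (ι (A i j) * x j)))        ≡⟨ ∑-cong (λ i → trans (∑-*ˡ (y i) (λ j → ι (A i j) * x j)) (ℚ.*-comm (y i) (rowDot A i x))) ⟩
  ∑ (λ i → rowDot A i x * y i)                       ∎
  where
  open ≡-Reasoning
  rotate : ∀ a b c → a * (b * c) ≡ c * (b * a)
  rotate = solve-∀ ℚ-ring

-- Dual optima supported on tight rows, and their values.

Tight : ∀ {m n} → Mat m n → (Fin m → ℤ) → (Fin n → ℚ) → Fin m → Set
Tight A b x i = rowDot A i x ≡ ι (b i)

-- The single primal point x compares all dual solutions: bᵀy = (Ax)ᵀy = wᵀx = (Ax)ᵀy′, and this is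
-- at most bᵀy′ because y′ is nonnegative.
complementarySlackness : ∀ {m n} (A : Mat m n) b {w x y} → InP A b x → DualFeasible A w y →
  (∀ i → y i ≡ 0ℚ ⊎ Tight A b x i) → DualOptimal A b w y
complementarySlackness A b {w} {x} {y} x∈P feasible slack = feasible , λ y′ feasible′ → begin
  ∑ (λ i → ι (b i) * y i)         ≡⟨ ∑-cong (λ i → tight (slack i)) ⟨
  ∑ (λ i → rowDot A i x * y i)    ≡⟨ colDot-rowDot A x y ⟨
  ∑ (λ j → colDot A j y * x j)    ≡⟨ ∑-cong (λ j → cong (_* x j) (trans (proj₁ feasible j) (sym (proj₁ feasible′ j)))) ⟩
  ∑ (λ j → colDot A j y′ * x j)   ≡⟨ colDot-rowDot A x y′ ⟩
  ∑ (λ i → rowDot A i x * y′ i)   ≤⟨ ∑-mono-≤ (λ i → ℚ.*-monoʳ-≤-nonNeg (y′ i) {{ℚ.nonNegative (proj₂ feasible′ i)}} (x∈P i)) ⟩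
  ∑ (λ i → ι (b i) * y′ i)        ∎
  where
  open ℚ.≤-Reasoning
  tight : ∀ {i} → y i ≡ 0ℚ ⊎ Tight A b x i → rowDot A i x * y i ≡ ι (b i) * y i
  tight {i} (inj₁ yᵢ≡0) rewrite yᵢ≡0 = trans (ℚ.*-zeroʳ (rowDot A i x)) (sym (ℚ.*-zeroʳ (ι (b i))))
  tight {i} (inj₂ eq)   = cong (_* y i) eq

dot-isPAdic : ∀ p {n} (a : Fin n → ℤ) {y : Fin n → ℚ} → (∀ i → IsPAdic p (y i)) →
  IsPAdic p (dot (λ i → ι (a i)) y)
dot-isPAdic p {zero}  a y-p = 0 , 0ℤ , refl
dot-isPAdic p {suc n} a {y} y-p
  with k , c , yp≡ ← y-p zero | l , d , sp≡ ← dot-isPAdic p (λ i → a (suc i)) (λ i → y-p (suc i)) =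
  k ℕ.+ l , a zero ℤ.* c ℤ.* + (p ℕ.^ l) ℤ.+ d ℤ.* + (p ℕ.^ k) , (begin
    (α * y zero + s) * ι (+ (p ℕ.^ (k ℕ.+ l)))   ≡⟨ cong (λ r → (α * y zero + s) * r) p^k+l ⟩
    (α * y zero + s) * (P * Q)                   ≡⟨ distribute α (y zero) s P Q ⟩
    α * (y zero * P) * Q + s * Q * P             ≡⟨ cong₂ (λ r t → α * r * Q + t * P) yp≡ sp≡ ⟩
    α * ι c * Q + ι d * P                        ≡⟨ cong (λ r → r * Q + ι d * P) (ι-* (a zero) c) ⟨
    ι (a zero ℤ.* c) * Q + ι d * P               ≡⟨ cong₂ _+_ (ι-* (a zero ℤ.* c) (+ (p ℕ.^ l))) (ι-* d (+ (p ℕ.^ k))) ⟨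
    ι (a zero ℤ.* c ℤ.* + (p ℕ.^ l)) + ι (d ℤ.* + (p ℕ.^ k)) ≡⟨ ι-+ (a zero ℤ.* c ℤ.* + (p ℕ.^ l)) (d ℤ.* + (p ℕ.^ k)) ⟨
    ι (a zero ℤ.* c ℤ.* + (p ℕ.^ l) ℤ.+ d ℤ.* + (p ℕ.^ k)) ∎)
  where
  open ≡-Reasoning
  α = ι (a zero)
  s = dot (λ i → ι (a (suc i))) (λ i → y (suc i))
  P = ι (+ (p ℕ.^ k))
  Q = ι (+ (p ℕ.^ l))
  p^k+l : ι (+ (p ℕ.^ (k ℕ.+ l))) ≡ P * Q
  p^k+l = trans (cong ι (trans (cong +_ (ℕ.^-distribˡ-+-* p k l)) (ℤ.pos-* (p ℕ.^ k) (p ℕ.^ l)))) (ι-* (+ (p ℕ.^ k)) (+ (p ℕ.^ l)))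
  distribute : ∀ α y s P Q → (α * y + s) * (P * Q) ≡ α * (y * P) * Q + s * Q * P
  distribute = solve-∀ ℚ-ring

module _ {m n} (A : Mat m n) (b : Fin m → ℤ) where

  -- u / N is an optimal dual solution, so its value (u·b)/N is p-adic.
  tight-combination-pAdic : ∀ p {x} → TotallyDualPAdic p A b → InP A b x →
    ∀ N .{{_ : ℕ.NonZero N}} (u : Fin m → ℕ) → (∀ i → u i ≡ 0 ⊎ Tight A b x i) →
    (∀ j → + N ∣ (λ i → + u i) · (λ i → A i j)) →
    ∃[ k ] + N ∣ + (p ℕ.^ k) ℤ.* ((λ i → + u i) · b)
  tight-combination-pAdic p {x} tdp x∈P N u supp N∣uA
    = conclusion (tdp w (Y , Y-optimal))
    where
    open ≡-Reasoning
    r : ℚ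
    r = + 1 / N
    rN≡1 : r * ι (+ N) ≡ 1ℚ
    rN≡1 = a/n*n (+ 1) N
    w : Fin n → ℤ
    w j = quotient (N∣uA j)
    Y : Fin m → ℚ
    Y i = ι (+ u i) * r
    dot-Y : ∀ v → dot (λ i → ι (v i)) Y ≡ ι ((λ i → + u i) · v) * r
    dot-Y v = trans (dot-scale (λ i → ι (v i)) (λ i → ι (+ u i)) r) (cong (_* r) (ι-dot (λ i → + u i) v))
    Y-feasible : DualFeasible A w Y
    Y-feasible = (λ j → begin
        colDot A j Y                             ≡⟨ dot-Y (λ i → A i j) ⟩
        ι ((λ i → + u i) · (λ i → A i j)) * r    ≡⟨ cong (λ z → ι z * r) (_∣_.equality (N∣uA j)) ⟩
        ι (w j ℤ.* + N) * r                      ≡⟨ cong (_* r) (ι-* (w j) (+ N)) ⟩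
        ι (w j) * ι (+ N) * r                    ≡⟨ rotate (ι (w j)) (ι (+ N)) r ⟩
        ι (w j) * (r * ι (+ N))                  ≡⟨ cong (ι (w j) *_) rN≡1 ⟩
        ι (w j) * 1ℚ                             ≡⟨ ℚ.*-identityʳ (ι (w j)) ⟩
        ι (w j)                                  ∎)
      , λ i → ℚ.nonNegative⁻¹ (Y i) {{ℚ.nonNeg*nonNeg⇒nonNeg (ι (+ u i)) {{ℚ.normalize-nonNeg (u i) 1}} r {{ℚ.normalize-nonNeg 1 N}}}}
      where
      rotate : ∀ a b c → a * b * c ≡ a * (c * b)
      rotate = solve-∀ ℚ-ring
    Y-optimal : DualOptimal A b w Y
    Y-optimal = complementarySlackness A b {w} x∈P Y-feasible λ i → map-⊎ (λ uᵢ≡0 → trans (cong (λ k → ι (+ k) * r) uᵢ≡0) (ℚ.*-zeroˡ r)) id (supp i)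
    conclusion : ∃[ y ] (DualOptimal A b w y × (∀ i → IsPAdic p (y i))) →
      ∃[ k ] + N ∣ + (p ℕ.^ k) ℤ.* ((λ i → + u i) · b)
    conclusion (y , (feasible , optimal) , y-p) with k , a , yp≡a ← dot-isPAdic p b y-p =
      k , divides a (ι-injective _ _ (begin
        ι (+ (p ℕ.^ k) ℤ.* β)                ≡⟨ ι-* (+ (p ℕ.^ k)) β ⟩
        ι (+ (p ℕ.^ k)) * ι β                ≡⟨ ℚ.*-identityʳ _ ⟨
        ι (+ (p ℕ.^ k)) * ι β * 1ℚ           ≡⟨ cong (ι (+ (p ℕ.^ k)) * ι β *_) rN≡1 ⟨
        ι (+ (p ℕ.^ k)) * ι β * (r * ι (+ N)) ≡⟨ rotate (ι (+ (p ℕ.^ k))) (ι β) r (ι (+ N)) ⟩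
        ι β * r * ι (+ (p ℕ.^ k)) * ι (+ N)  ≡⟨ cong (λ v → v * ι (+ (p ℕ.^ k)) * ι (+ N)) (trans (sym (dot-Y b)) values) ⟩
        dot (λ i → ι (b i)) y * ι (+ (p ℕ.^ k)) * ι (+ N) ≡⟨ cong (_* ι (+ N)) yp≡a ⟩
        ι a * ι (+ N)                        ≡⟨ ι-* a (+ N) ⟨
        ι (a ℤ.* + N)                        ∎))
      where
      β : ℤ
      β = (λ i → + u i) · b
      values : dot (λ i → ι (b i)) Y ≡ dot (λ i → ι (b i)) y
      -- The p-adic solution `y` need not equal `Y`, but two optima have the same value, so the
      -- p-adic value of `y` is β / N.
      values = ℚ.≤-antisym (proj₂ Y-optimal y feasible) (optimal Y Y-feasible)
      rotate : ∀ P β r N → P * β * (r * N) ≡ β * r * P * N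
      rotate = solve-∀ ℚ-ring

-- Coprime prime powers, and the ratio test along a direction.

coprime-*ˡ : ∀ {a b n} → Coprime a n → Coprime b n → Coprime (a ℕ.* b) n
coprime-*ˡ {a} {b} a⊥n b⊥n {d} (d∣ab , d∣n) =
  b⊥n (coprime-divisor {d} {a} (λ { (e∣d , e∣a) → a⊥n (e∣a , ℕ.∣-trans e∣d d∣n) }) d∣ab , d∣n)

coprime-^ˡ : ∀ {a n} k → Coprime a n → Coprime (a ℕ.^ k) n
coprime-^ˡ {n = n} zero a⊥n = Coprime.1-coprimeTo n
coprime-^ˡ (suc k) a⊥n = coprime-*ˡ a⊥n (coprime-^ˡ k a⊥n)

distinctPrimes-coprime : ∀ {p q} → Prime p → Prime q → p ≢ q → Coprime p q
distinctPrimes-coprime p-prime q-prime p≢q (d∣p , d∣q)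
  with prime⇒irreducible p-prime d∣p | prime⇒irreducible q-prime d∣q
... | inj₁ d≡1 | _        = d≡1
... | inj₂ _   | inj₁ d≡1 = d≡1
... | inj₂ d≡p | inj₂ d≡q = contradiction (trans (sym d≡p) d≡q) p≢q

-- For `N` nonzero, the reduced denominator of z / N divides both `a` and `c`, so it is 1. With
-- powers of the two primes, this makes a value that is both p-adic and q-adic an integer.
∣-coprime-multiples : ∀ {a c N} z → Coprime a c → N ∣ + a ℤ.* z → N ∣ + c ℤ.* z → N ∣ z
∣-coprime-multiples {a} {c} {N} z a⊥c N∣az N∣cz = ∣ᵤ⇒∣ (coprime-factors a⊥c (unsigned a N∣az , unsigned c N∣cz))
  where
  unsigned : ∀ e → N ∣ + e ℤ.* z → ℤ.∣ N ∣ ℕ.∣ e ℕ.* ℤ.∣ z ∣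
  unsigned e N∣ez = subst (ℤ.∣ N ∣ ℕ.∣_) (ℤ.abs-* (+ e) z) (∣⇒∣ᵤ N∣ez)

-- The minimum ratio test of the simplex method, with the step capped at 1.
stepLength : ∀ {m} (f g : Fin m → ℚ) → (∀ i → 0ℚ ≤ f i) →
  ∃[ r ] (0ℚ ≤ r × (∀ i → r * g i ≤ f i) × (r ≡ 1ℚ ⊎ ∃[ i ] (r * g i ≡ f i × 0ℚ < g i)))
stepLength {zero} f g 0≤f = 1ℚ , ℚ.nonNegative⁻¹ 1ℚ , (λ ()) , inj₁ refl
stepLength {suc m} f g 0≤f
  with r , 0≤r , rg≤f , reason ← stepLength (λ i → f (suc i)) (λ i → g (suc i)) (λ i → 0≤f (suc i))
  with r * g zero ℚ.≤? f zero
... | yes rg₀≤f₀ = r , 0≤r , (λ { zero → rg₀≤f₀ ; (suc i) → rg≤f i }) ,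
  map-⊎ id (λ { (i , blocked) → suc i , blocked }) reason
... | no rg₀≰f₀ = r′ , 0≤r′ , (λ { zero → ℚ.≤-reflexive r′g₀≡f₀ ; (suc i) → r′g≤f i }) , inj₂ (zero , r′g₀≡f₀ , 0<g₀)
  where
  open ℚ.≤-Reasoning
  0<g₀ : 0ℚ < g zero
  0<g₀ = ℚ.*-cancelˡ-<-nonNeg r {{ℚ.nonNegative 0≤r}} (begin-strict
    r * 0ℚ      ≡⟨ ℚ.*-zeroʳ r ⟩
    0ℚ          ≤⟨ 0≤f zero ⟩
    f zero      <⟨ ℚ.≰⇒> rg₀≰f₀ ⟩
    r * g zero  ∎)
  instance
    g₀-positive : ℚ.Positive (g zero)
    g₀-positive = ℚ.positive 0<g₀
    g₀-nonZero : ℚ.NonZero (g zero)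
    g₀-nonZero = ℚ.pos⇒nonZero (g zero)
  r′ : ℚ
  r′ = f zero * ℚ.1/ g zero
  r′g₀≡f₀ : r′ * g zero ≡ f zero
  r′g₀≡f₀ = trans (ℚ.*-assoc (f zero) _ _) (trans (cong (f zero *_) (ℚ.*-inverseˡ (g zero))) (ℚ.*-identityʳ (f zero)))
  0≤r′ : 0ℚ ≤ r′
  0≤r′ = ℚ.*-cancelʳ-≤-pos (g zero) (begin
    0ℚ * g zero  ≡⟨ ℚ.*-zeroˡ (g zero) ⟩
    0ℚ           ≤⟨ 0≤f zero ⟩
    f zero       ≡⟨ r′g₀≡f₀ ⟨
    r′ * g zero  ∎)
  r′≤r : r′ ≤ r
  r′≤r = ℚ.*-cancelʳ-≤-pos (g zero) (begin
    r′ * g zero  ≡⟨ r′g₀≡f₀ ⟩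
    f zero       ≤⟨ ℚ.<⇒≤ (ℚ.≰⇒> rg₀≰f₀) ⟩
    r * g zero   ∎)
  r′g≤f : ∀ i → r′ * g (suc i) ≤ f (suc i)
  -- Shortening the step preserves the bound only where g is nonnegative; where g is nonpositive,
  -- the product is at most 0, hence at most f.
  r′g≤f i with ℚ.≤-total (g (suc i)) 0ℚ
  ... | inj₁ g≤0 = begin
    r′ * g (suc i)  ≤⟨ ℚ.*-monoˡ-≤-nonNeg r′ {{ℚ.nonNegative 0≤r′}} g≤0 ⟩
    r′ * 0ℚ         ≡⟨ ℚ.*-zeroʳ r′ ⟩
    0ℚ              ≤⟨ 0≤f (suc i) ⟩
    f (suc i)       ∎
  ... | inj₂ 0≤g = begin
    r′ * g (suc i)  ≤⟨ ℚ.*-monoʳ-≤-nonNeg (g (suc i)) {{ℚ.nonNegative 0≤g}} r′≤r ⟩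
    r * g (suc i)   ≤⟨ rg≤f i ⟩
    f (suc i)       ∎

-- Restriction to a set of rows and reduction of multipliers modulo N.

module _ {m} {P : Pred (Fin m) 0ℓ} (P? : Decidable P) where

  -- Discarded rows are overwritten by `z` instead of being removed, so a tight subsystem keeps the
  -- index type `Fin m`.
  restrict : {B : Set} → B → (Fin m → B) → Fin m → B
  restrict z v i with P? i
  ... | yes _ = v i
  ... | no  _ = z

  restrict-yes : ∀ {B : Set} {z : B} v {i} → P i → restrict z v i ≡ v i
  restrict-yes v {i} Pi with P? i
  ... | yes _  = refl
  ... | no ¬Pi = contradiction Pi ¬Pi

  restrict-support : ∀ {B : Set} (z : B) v i → restrict z v i ≡ z ⊎ P i
  restrict-support z v i with P? i
  ... | yes Pi = inj₂ Pi
  ... | no  _  = inj₁ refl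

  -- Multipliers may be reduced modulo N, which makes them nonnegative as dual solutions must be.
  residues : ∀ N .{{_ : ℕ.NonZero N}} → (Fin m → ℤ) → Fin m → ℕ
  residues N y = restrict 0 (λ i → y i ℤ.%ℕ N)

  -- The restriction moves from the vector to the multiplier: inside `P` this is division with
  -- remainder, outside `P` both sides contribute zero. Divisibility by `N` therefore transfers in
  -- both directions.
  ·-residues : ∀ N .{{_ : ℕ.NonZero N}} y v →
    ∃[ k ] y · restrict 0ℤ v ≡ (λ i → + residues N y i) · v ℤ.+ + N ℤ.* k
  ·-residues N y v = sum k , (begin
    y · restrict 0ℤ v                            ≡⟨ sum-cong-≗ pointwise ⟩
    sum (λ i → + residues N y i ℤ.* v i ℤ.+ + N ℤ.* k i) ≡⟨ ∑-distrib-+ (λ i → + residues N y i ℤ.* v i) (λ i → + N ℤ.* k i) ⟩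
    (λ i → + residues N y i) · v ℤ.+ sum (λ i → + N ℤ.* k i) ≡⟨ cong (λ s → (λ i → + residues N y i) · v ℤ.+ s) (*-distribˡ-sum (+ N) k) ⟨
    (λ i → + residues N y i) · v ℤ.+ + N ℤ.* sum k ∎)
    where
    open ≡-Reasoning
    k : Fin m → ℤ
    k i = y i ℤ./ℕ N ℤ.* restrict 0ℤ v i
    expand : ∀ r q n v → (r ℤ.+ q ℤ.* n) ℤ.* v ≡ r ℤ.* v ℤ.+ n ℤ.* (q ℤ.* v)
    expand = ℤ-Solver.solve-∀
    vanish : ∀ y n q v → y ℤ.* 0ℤ ≡ 0ℤ ℤ.* v ℤ.+ n ℤ.* (q ℤ.* 0ℤ)
    vanish = ℤ-Solver.solve-∀
    pointwise : ∀ i → y i ℤ.* restrict 0ℤ v i ≡ + residues N y i ℤ.* v i ℤ.+ + N ℤ.* k i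
    pointwise i with P? i
    ... | yes _ = trans (cong (ℤ._* v i) (ℤ.a≡a%ℕn+[a/ℕn]*n (y i) N)) (expand (+ (y i ℤ.%ℕ N)) (y i ℤ./ℕ N) (+ N) (v i))
    ... | no  _ = vanish (y i) (+ N) (y i ℤ./ℕ N) (v i)

  restricted⇒residues : ∀ N .{{_ : ℕ.NonZero N}} y v →
    + N ∣ y · restrict 0ℤ v → + N ∣ (λ i → + residues N y i) · v
  restricted⇒residues N y v N∣yv with k , eq ← ·-residues N y v =
    ∣m+n∣n⇒∣m (subst (+ N ∣_) eq N∣yv) (∣m⇒∣m*n k ∣-refl)

  residues⇒restricted : ∀ N .{{_ : ℕ.NonZero N}} y v →
    + N ∣ (λ i → + residues N y i) · v → + N ∣ y · restrict 0ℤ v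
  residues⇒restricted N y v N∣uv with k , eq ← ·-residues N y v =
    subst (+ N ∣_) (sym eq) (∣m∣n⇒∣m+n N∣uv (∣m⇒∣m*n k ∣-refl))

p≤q⇒0≤q-p : ∀ {p q} → p ≤ q → 0ℚ ≤ q - p
p≤q⇒0≤q-p {p} {q} p≤q = subst (_≤ q - p) (ℚ.+-inverseʳ p) (ℚ.+-monoˡ-≤ (- p) p≤q)

add-sub : ∀ a c → a + (c - a) ≡ c
add-sub = solve-∀ ℚ-ring

-- Integral solutions of tight systems and motion within a face.

module _ {m n} (A : Mat m n) (b : Fin m → ℤ) where

  tight? : ∀ x → Decidable (Tight A b x)
  tight? x i = rowDot A i x ℚ.≟ ι (b i)

  TightSolution : (Fin n → ℚ) → Set
  TightSolution x = Σ[ z ∈ (Fin n → ℤ) ] (∀ i → Tight A b x i → Tight A b (λ j → ι (z j)) i)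

  tightSystem-integral : ∀ {p q} → Prime p → Prime q → p ≢ q →
    TotallyDualPAdic p A b → TotallyDualPAdic q A b → ∀ x → InP A b x →
    TightSolution x
  tightSystem-integral {p} {q} p-prime q-prime p≢q tdp tdq x x∈P
    -- Loose rows read 0 = 0 here, so the span coefficients `z` are constrained by the tight
    -- equations alone.
    = map₂ (λ {z} → solves {z}) (Span-coefficients (kronecker⁺ V (restrict T? 0ℤ b) divisibility))
    where
    T? = tight? x
    V : Fin n → Fin m → ℤ
    V j = restrict T? 0ℤ (λ i → A i j)
    divisibility : ∀ N .{{_ : ℕ.NonZero N}} y → (∀ j → + N ∣ y · V j) → + N ∣ y · restrict T? 0ℤ b
    divisibility N y N∣yV = residues⇒restricted T? N y b (coprime-powers (powers p tdp) (powers q tdq))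
      where
      u : Fin m → ℕ
      u = residues T? N y
      β : ℤ
      β = (λ i → + u i) · b
      powers : ∀ p → TotallyDualPAdic p A b → ∃[ k ] + N ∣ + (p ℕ.^ k) ℤ.* β
      powers p tdp = tight-combination-pAdic A b p tdp x∈P N u
        (restrict-support T? 0 (λ i → y i ℤ.%ℕ N))
        (λ j → restricted⇒residues T? N y (λ i → A i j) (N∣yV j))
      coprime-powers : ∃[ k ] + N ∣ + (p ℕ.^ k) ℤ.* β → ∃[ l ] + N ∣ + (q ℕ.^ l) ℤ.* β → + N ∣ β
      coprime-powers (k , N∣pᵏβ) (l , N∣qˡβ) = ∣-coprime-multiples β
        (coprime-^ˡ k (Coprime.sym (coprime-^ˡ l (Coprime.sym (distinctPrimes-coprime p-prime q-prime p≢q)))))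
        N∣pᵏβ N∣qˡβ
    solves : ∀ {z} → (∀ i → restrict T? 0ℤ b i ≡ z · (λ j → V j i)) →
      ∀ i → Tight A b x i → Tight A b (λ j → ι (z j)) i
    solves {z} b≡ i tight = begin
      rowDot A i (λ j → ι (z j))   ≡⟨ ι-dot z (A i) ⟩
      ι (z · A i)                  ≡⟨ cong ι (sum-cong-≗ (λ j → cong (z j ℤ.*_) (restrict-yes T? (λ i → A i j) tight))) ⟨
      ι (z · (λ j → V j i))        ≡⟨ cong ι (b≡ i) ⟨
      ι (restrict T? 0ℤ b i)       ≡⟨ cong ι (restrict-yes T? b tight) ⟩
      ι (b i)                      ∎
      where open ≡-Reasoning

  -- The strict sign makes a blocking row new: if `d` keeps the tight rows of `x` constant, a row
  -- that increases along `d` was not tight at `x`.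
  LineStep : (x d : Fin n → ℚ) → Set
  LineStep x d = ∃[ r ] (0ℚ ≤ r × InP A b (λ j → x j + r * d j) ×
    (r ≡ 1ℚ ⊎ ∃[ i ] (Tight A b (λ j → x j + r * d j) i × 0ℚ < rowDot A i d)))

  lineStep : ∀ x → InP A b x → ∀ d → LineStep x d
  lineStep x x∈P d
    with r , 0≤r , rg≤f , reason ← stepLength (λ i → ι (b i) - rowDot A i x) (λ i → rowDot A i d) (λ i → p≤q⇒0≤q-p (x∈P i)) =
    r , 0≤r , (λ i → begin
      rowDot A i (λ j → x j + r * d j)              ≡⟨ dot-line (λ j → ι (A i j)) x d r ⟩
      rowDot A i x + r * rowDot A i d               ≤⟨ ℚ.+-monoʳ-≤ (rowDot A i x) (rg≤f i) ⟩
      rowDot A i x + (ι (b i) - rowDot A i x)       ≡⟨ add-sub (rowDot A i x) (ι (b i)) ⟩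
      ι (b i)                                       ∎) ,
    map-⊎ id (λ { (i , rg≡f , 0<g) → i , trans (dot-line (λ j → ι (A i j)) x d r)
        (trans (cong (λ s → rowDot A i x + s) rg≡f) (add-sub (rowDot A i x) (ι (b i)))) , 0<g }) reason
    where open ℚ.≤-Reasoning

  module _ (c : Fin n → ℚ) (δ : ℚ) (valid : ∀ x → InP A b x → dot c x ≤ δ) where

    -- Rows tight at `x` are constant along `d` and the others have slack, so some positive step
    -- stays in the polyhedron; there validity bounds the objective by its value at `x`.
    objective-nonincreasing : ∀ x → InP A b x → dot c x ≡ δ →
      ∀ d → (∀ i → Tight A b x i → rowDot A i d ≡ 0ℚ) → dot c d ≤ 0ℚ
    objective-nonincreasing x x∈P cx≡δ d tight⇒0 = bound (lineStep x x∈P d)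
      where
      open ℚ.≤-Reasoning
      sub-add : ∀ a s → s ≡ a + s - a
      sub-add = solve-∀ ℚ-ring
      -- After a zero step, the blocking row would already be tight at `x`, hence constant along
      -- `d`, although it increases.
      r≢0 : ∀ {r} → r ≡ 1ℚ ⊎ ∃[ i ] (Tight A b (λ j → x j + r * d j) i × 0ℚ < rowDot A i d) → r ≢ 0ℚ
      r≢0 (inj₁ r≡1) r≡0 with () ← trans (sym r≡1) r≡0
      r≢0 {r} (inj₂ (i , tight , 0<Ad)) r≡0 = ℚ.<⇒≢ 0<Ad (sym (tight⇒0 i (trans (sym stationary) tight)))
        where
        stationary : rowDot A i (λ j → x j + r * d j) ≡ rowDot A i x
        stationary = begin-equality
          rowDot A i (λ j → x j + r * d j)   ≡⟨ dot-line (λ j → ι (A i j)) x d r ⟩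
          rowDot A i x + r * rowDot A i d    ≡⟨ cong (λ s → rowDot A i x + s * rowDot A i d) r≡0 ⟩
          rowDot A i x + 0ℚ * rowDot A i d   ≡⟨ cong (λ s → rowDot A i x + s) (ℚ.*-zeroˡ (rowDot A i d)) ⟩
          rowDot A i x + 0ℚ                  ≡⟨ ℚ.+-identityʳ (rowDot A i x) ⟩
          rowDot A i x                       ∎
      bound : LineStep x d → dot c d ≤ 0ℚ
      bound (r , 0≤r , x′∈P , reason) = ℚ.*-cancelˡ-≤-pos r
        {{ℚ.nonNeg∧nonZero⇒pos r {{ℚ.nonNegative 0≤r}} {{ℚ.≢-nonZero (r≢0 reason)}}}} (begin
        r * dot c d                                 ≡⟨ sub-add (dot c x) (r * dot c d) ⟩
        dot c x + r * dot c d - dot c x             ≡⟨ cong (_- dot c x) (dot-line c x d r) ⟨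
        dot c (λ j → x j + r * d j) - dot c x       ≤⟨ ℚ.+-monoˡ-≤ (- dot c x) (valid (λ j → x j + r * d j) x′∈P) ⟩
        δ - dot c x                                 ≡⟨ cong (λ s → δ - s) cx≡δ ⟩
        δ - δ                                       ≡⟨ ℚ.+-inverseʳ δ ⟩
        0ℚ                                          ≡⟨ ℚ.*-zeroʳ r ⟨
        r * 0ℚ                                      ∎)

    -- The condition on `d` is invariant under change of sign, so the previous bound applies to -d
    -- as well. This replaces a Farkas-type expression of c by the tight rows.
    objective-constant : ∀ x → InP A b x → dot c x ≡ δ →
      ∀ d → (∀ i → Tight A b x i → rowDot A i d ≡ 0ℚ) → dot c d ≡ 0ℚ
    objective-constant x x∈P cx≡δ d tight⇒0 = ℚ.≤-antisym
      (objective-nonincreasing x x∈P cx≡δ d tight⇒0)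
      (nonneg (subst (_≤ 0ℚ) (dot-scale c d (- 1ℚ)) (objective-nonincreasing x x∈P cx≡δ (λ j → d j * - 1ℚ)
        (λ i tight → trans (dot-scale (λ j → ι (A i j)) d (- 1ℚ)) (cong (_* - 1ℚ) (tight⇒0 i tight))))))
      where
      open ℚ.≤-Reasoning
      nonneg : ∀ {s} → s * - 1ℚ ≤ 0ℚ → 0ℚ ≤ s
      nonneg {s} s≤0 = begin
        0ℚ              ≤⟨ ℚ.neg-antimono-≤ s≤0 ⟩
        - (s * - 1ℚ)    ≡⟨ negate s ⟩
        s               ∎
        where
        negate : ∀ s → - (s * - 1ℚ) ≡ s
        negate = solve-∀ ℚ-ring

    module _ (tightSystem : ∀ x → InP A b x → TightSolution x) where

      -- R over-approximates the rows that are not tight at x.  The segment from x to an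
      -- integral solution of the tight rows stays in the face until a new row gets tight.
      descend : ∀ fuel (R : List (Fin m)) → length R ℕ.< fuel →
        ∀ x → InP A b x → dot c x ≡ δ → (∀ i → i ∈ R ⊎ Tight A b x i) →
        ∃[ z ] (IsIntegral z × InP A b z × dot c z ≡ δ)
      descend (suc fuel) R (ℕ.s≤s |R|≤fuel) x x∈P cx≡δ cover = towards (tightSystem x x∈P)
        where
        towards : TightSolution x → ∃[ z ] (IsIntegral z × InP A b z × dot c z ≡ δ)
        towards (z , tight-z) = step (lineStep x x∈P d)
          where
          d : Fin n → ℚ
          d j = ι (z j) - x j
          tight⇒0 : ∀ i → Tight A b x i → rowDot A i d ≡ 0ℚ
          tight⇒0 i tight = begin
            rowDot A i d                                      ≡⟨ ∑-cong (λ j → cong (λ s → ι (A i j) * s) (flip (ι (z j)) (x j))) ⟩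
            rowDot A i (λ j → ι (z j) + - 1ℚ * x j)           ≡⟨ dot-line (λ j → ι (A i j)) (λ j → ι (z j)) x (- 1ℚ) ⟩
            rowDot A i (λ j → ι (z j)) + - 1ℚ * rowDot A i x  ≡⟨ cong₂ (λ s t → s + - 1ℚ * t) (tight-z i tight) tight ⟩
            ι (b i) + - 1ℚ * ι (b i)                          ≡⟨ flip (ι (b i)) (ι (b i)) ⟨
            ι (b i) - ι (b i)                                 ≡⟨ ℚ.+-inverseʳ (ι (b i)) ⟩
            0ℚ                                                ∎
            where
            open ≡-Reasoning
            flip : ∀ z x → z - x ≡ z + - 1ℚ * x
            flip = solve-∀ ℚ-ring
          step : LineStep x d → ∃[ z ] (IsIntegral z × InP A b z × dot c z ≡ δ)
          step (r , _ , x′∈P , reason) = continue reason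
            where
            x′ : Fin n → ℚ
            x′ j = x j + r * d j
            cx′≡δ : dot c x′ ≡ δ
            cx′≡δ = begin
              dot c x′                ≡⟨ dot-line c x d r ⟩
              dot c x + r * dot c d   ≡⟨ cong₂ (λ s t → s + r * t) cx≡δ (objective-constant x x∈P cx≡δ d tight⇒0) ⟩
              δ + r * 0ℚ              ≡⟨ cong (λ s → δ + s) (ℚ.*-zeroʳ r) ⟩
              δ + 0ℚ                  ≡⟨ ℚ.+-identityʳ δ ⟩
              δ                       ∎
              where open ≡-Reasoning
            tight-x′ : ∀ i → Tight A b x i → Tight A b x′ i
            tight-x′ i tight = begin
              rowDot A i x′                     ≡⟨ dot-line (λ j → ι (A i j)) x d r ⟩
              rowDot A i x + r * rowDot A i d   ≡⟨ cong₂ (λ s t → s + r * t) tight (tight⇒0 i tight) ⟩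
              ι (b i) + r * 0ℚ                  ≡⟨ cong (λ s → ι (b i) + s) (ℚ.*-zeroʳ r) ⟩
              ι (b i) + 0ℚ                      ≡⟨ ℚ.+-identityʳ (ι (b i)) ⟩
              ι (b i)                           ∎
              where open ≡-Reasoning
            loose? : Decidable (λ i → ¬ Tight A b x′ i)
            loose? i = ¬? (tight? x′ i)
            cover′ : ∀ i → i ∈ filter loose? R ⊎ Tight A b x′ i
            cover′ i with tight? x′ i | cover i
            ... | yes tight  | _          = inj₂ tight
            ... | no ¬tight  | inj₁ i∈R   = inj₁ (∈-filter⁺ loose? i∈R ¬tight)
            ... | no ¬tight  | inj₂ tight = contradiction (tight-x′ i tight) ¬tight
            continue : r ≡ 1ℚ ⊎ ∃[ i ] (Tight A b x′ i × 0ℚ < rowDot A i d) →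
              ∃[ z ] (IsIntegral z × InP A b z × dot c z ≡ δ)
            continue (inj₁ r≡1) =
              x′ , (λ j → z j , trans (cong (λ s → x j + s * d j) r≡1) (x+1d≡z (x j) (ι (z j)))) , x′∈P , cx′≡δ
              where
              x+1d≡z : ∀ x z → x + 1ℚ * (z - x) ≡ z
              x+1d≡z = solve-∀ ℚ-ring
            continue (inj₂ (i , tight-i , 0<Ad)) with cover i
            ... | inj₂ tight = contradiction (sym (tight⇒0 i tight)) (ℚ.<⇒≢ 0<Ad)
            -- The blocking row lies in `R` and is tight at `x′`, so filtering removes it and the
            -- list gets strictly shorter.
            ... | inj₁ i∈R   = descend fuel (filter loose? R)
              (ℕ.<-≤-trans (filter-notAll loose? R (lose i∈R (λ loose → loose tight-i))) |R|≤fuel)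
              x′ x′∈P cx′≡δ cover′

theorem1p5 : ∀ {m n : ℕ} (A : Mat m n) (b : Fin m → ℤ) (p q : ℕ) →
    Prime p → Prime q → p ≢ q →
    TotallyDualPAdic p A b → TotallyDualPAdic q A b →
    IsIntegralPolyhedron A b
theorem1p5 {m} A b p q p-prime q-prime p≢q tdp tdq c δ valid (x , x∈P , cx≡δ) =
  descend A b c δ valid (tightSystem-integral A b p-prime q-prime p≢q tdp tdq)
    -- The list of all rows is a cover at any starting point; the successor is there because the
    -- fuel bound is strict.
    (suc (length (allFin m))) (allFin m) ℕ.≤-refl x x∈P cx≡δ (λ i → inj₁ (∈-allFin i))
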